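{- Let $k\geq 3$, $n_1=\cdots=n_k\geq 2$ and $r\in\{1,\dots,k\}$. The number of distinct isomorphism classes of graphs in the LC orbit of the clique-star $CS^r_{n_1,\dots,n_k}$ is $$\left|\mathcal{O}(CS^r_{n_1,\dots,n_k})/\cong\right| = \left\lceil \tfrac{k}{2}\right\rceil + k.$$
   Context: Local complement $c_v(G)$: replace the subgraph induced on the neighbourhood of $v$ by its complement, leaving all other edges unchanged. $\mathcal{O}(G)$ is the set of labeled graphs on the vertex set of $G$ obtainable from $G$ by finite sequences of local complements; $\mathcal{O}(G)/\cong$ is this set modulo graph isomorphism. The clique-star $CS^r_{n_1,\dots,n_k}$ has vertex set $U_1\sqcup\cdots\sqcup U_k$ with $|U_i|=n_i$; each $U_i$ is a clique, every vertex of $U_r$ is adjacent to every vertex of every $U_i$ ($i\neq r$), and there are no other edges. -}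

module Defs where

open import Data.Nat using (ℕ; _*_)
open import Data.Fin using (Fin; _≟_; quotient)
open import Data.Bool using (Bool; true; false; not; _∧_; _∨_; if_then_else_)
open import Data.List using (List; []; _∷_)
open import Data.Product using (Σ; Σ-syntax; ∃; ∃-syntax; _×_)
open import Relation.Nullary using (¬_)
open import Relation.Nullary.Decidable using (⌊_⌋)
open import Relation.Binary.PropositionalEquality using (_≡_)
open import Function.Bundles using (_↔_; Inverse)

-- A (labeled, simple) graph on vertex set Fin N, given by its adjacency function.
-- All graphs arising below are symmetric and irreflexive.
Graph : ℕ → Set
Graph N = Fin N → Fin N → Bool

lc : ∀ {N} → Fin N → Graph N → Graph N
lc v A i j = if not ⌊ i ≟ j ⌋ ∧ A v i ∧ A v j then not (A i j) else A i j

lcSeq : ∀ {N} → List (Fin N) → Graph N → Graph N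
lcSeq []       A = A
lcSeq (v ∷ vs) A = lcSeq vs (lc v A)

InOrbit : ∀ {N} → Graph N → Graph N → Set
InOrbit G H = Σ[ vs ∈ List (Fin _) ] (∀ i j → lcSeq vs G i j ≡ H i j)

Iso : ∀ {N} → Graph N → Graph N → Set
Iso {N} A B = Σ[ σ ∈ Fin N ↔ Fin N ] (∀ i j → A i j ≡ B (Inverse.to σ i) (Inverse.to σ j))

OrbitIsoClassCount : ∀ {N} → Graph N → ℕ → Set
OrbitIsoClassCount {N} G m =
  Σ[ rep ∈ (Fin m → Graph N) ]
    ((∀ a → InOrbit G (rep a))
    × (∀ a b → Iso (rep a) (rep b) → a ≡ b)
    × (∀ H → InOrbit G H → ∃[ a ] Iso H (rep a)))

-- Clique-star CS^r_{n,...,n} with k blocks of size n; vertex set Fin (k * n),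
-- vertex i lies in block U_(quotient {k} n i).
cliqueStar : (k n : ℕ) → Fin k → Graph (k * n)
cliqueStar k n r i j =
  not ⌊ i ≟ j ⌋ ∧
  (⌊ quotient {k} n i ≟ quotient {k} n j ⌋ ∨ ⌊ quotient {k} n i ≟ r ⌋ ∨ ⌊ quotient {k} n j ≟ r ⌋)

{-# OPTIONS --safe #-}
-- Every graph in the orbit is described by its split tree: a centre node with k marker vertices, which is
-- complete (nothing) or a star with centre r (just r), and one node per block, which is a clique, an independent
-- set, or a star centred at one of its own vertices. A local complement acts node by node on such trees.
-- Starting from the clique-star, the parity of the number j of star blocks determines the rest: with a
-- complete centre node, j is odd and all other blocks are independent; with a star centre node, all other blocks
-- are cliques, except that the block r is independent when j is odd. So j ranges over the odd numbers up to k in the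
-- first case and over 0, …, k − 1 in the second. Up to isomorphism only j and the kind of the centre node matter;
-- conversely the star blocks are counted by the vertices having a pendant neighbour, and the centre node is
-- complete exactly when there is a triangle of pairwise non-twins.
module Submission where

open import Defs
open import Data.Nat using (ℕ; _+_; _≤_; ⌈_/2⌉)
open import Data.Fin using (Fin)
open import Data.Bool using (Bool; true; false; not; _∧_; _∨_; _xor_; if_then_else_)
open import Data.Bool.Properties using (xor-comm; ∧-comm; ∧-identityʳ; ∨-zeroʳ; ¬-not)
  renaming (_≟_ to _≟ᵇ_)
open import Data.Empty using (⊥)
open import Data.Fin using (zero; suc; _≟_; quotient; remainder; combine; toℕ; fromℕ<; punchIn; punchOut; splitAt; join)
open import Data.Fin.Permutation using (Permutation; transpose; insert; insert-punchIn; _⟨$⟩ʳ_; id)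
open import Data.Fin.Properties
  using ( any?; 0≢1+n; toℕ-fromℕ<; toℕ-injective; toℕ<n; combine-injectiveˡ; combine-injectiveʳ
        ; combine-remQuot; remQuot-combine; *↔×; splitAt-join; join-splitAt
        ; punchOut-injective; punchIn-punchOut; punchInᵢ≢i)
  renaming (suc-injective to Fin-suc-injective)
open import Data.List using (List; []; _∷_; _∷ʳ_)
open import Data.Maybe using (Maybe; just; nothing)
open import Data.Nat using (zero; suc; _*_; _<_; _<ᵇ_; z≤n; s≤s; s≤s⁻¹; ⌊_/2⌋)
open import Data.Nat.Properties
  using ( suc-injective; +-suc; +-comm; +-assoc; +-cancelˡ-≡; <⇒≤; ≤-reflexive; ≤-trans; ≤-antisym
        ; n≤1+n; 1+n≰n; n≡⌊n+n/2⌋)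
open import Data.Product using (Σ-syntax; ∃-syntax; _×_; _,_; proj₁; proj₂)
open import Data.Product.Function.Dependent.Propositional using (Σ-↔)
open import Data.Sum using (_⊎_; inj₁; inj₂)
open import Function using (_∘_; Inverse; Injection)
open import Function.Properties.Inverse using (↔-sym; ↔-trans; ↔⇒↣)
open import Relation.Binary.PropositionalEquality
open import Relation.Nullary using (¬_; Dec; yes; no; contradiction)
open import Relation.Nullary.Decidable using (⌊_⌋)

private variable
  N m k n : ℕ

-- Split trees and local complementation

⌊≟⌋-refl : (i : Fin m) → ⌊ i ≟ i ⌋ ≡ true
⌊≟⌋-refl i with i ≟ i
... | yes _ = refl
... | no i≢i = contradiction refl i≢i

⌊≟⌋-≢ : {i j : Fin m} → i ≢ j → ⌊ i ≟ j ⌋ ≡ false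
⌊≟⌋-≢ {i = i} {j} i≢j with i ≟ j
... | yes i≡j = contradiction i≡j i≢j
... | no _ = refl

⌊≟⌋⇒≡ : {i j : Fin m} → ⌊ i ≟ j ⌋ ≡ true → i ≡ j
⌊≟⌋⇒≡ {i = i} {j} e with yes p ← i ≟ j = p

⌊≟⌋-sym : (i j : Fin m) → ⌊ i ≟ j ⌋ ≡ ⌊ j ≟ i ⌋
⌊≟⌋-sym i j with i ≟ j
... | yes refl = sym (⌊≟⌋-refl i)
... | no i≢j = sym (⌊≟⌋-≢ (i≢j ∘ sym))

data BlockType (n : ℕ) : Set where
  clique indep : BlockType n
  star : Fin n → BlockType n

-- Adjacency to the marker vertex of the block's node. All vertices of an `indep` block reach it, so
-- as a node `indep` is the star centred at the marker.
reaches : BlockType n → Fin n → Bool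
reaches clique p = true
reaches indep p = true
reaches (star x) p = ⌊ x ≟ p ⌋

inner : BlockType n → Fin n → Fin n → Bool
inner clique p q = not ⌊ p ≟ q ⌋
inner indep p q = false
inner (star x) p q = ⌊ x ≟ p ⌋ xor ⌊ x ≟ q ⌋

-- In an `indep` block `q` is a leaf at the marker, and in a star centred elsewhere a leaf at that
-- centre; complementing at a leaf changes nothing.
lcAt : Fin n → BlockType n → BlockType n
lcAt q clique = star q
lcAt q indep = indep
lcAt q (star x) = if ⌊ x ≟ q ⌋ then clique else star x

-- Local complementation of the node at its marker: it exchanges the complete node with the star
-- centred at the marker and fixes the nodes in which the marker is a leaf.
toggle : BlockType n → BlockType n
toggle clique = indep
toggle indep = clique
toggle (star x) = star x

Centre : ℕ → Set
Centre k = Maybe (Fin k)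

link : Centre k → Fin k → Fin k → Bool
link nothing a b = true
link (just r) a b = ⌊ r ≟ a ⌋ ∨ ⌊ r ≟ b ⌋

lcCentre : Fin k → Centre k → Centre k
lcCentre b nothing = just b
lcCentre b (just r) = if ⌊ r ≟ b ⌋ then nothing else just r

Types : ℕ → ℕ → Set
Types k n = Fin k → BlockType n

-- Accessibility in the split tree: a path between different blocks runs through both markers and
-- the centre node, so `link` is consulted only for `a` different from `b`.
adj : Centre k → Types k n → Fin k → Fin n → Fin k → Fin n → Bool
adj c t a p b q =
  if ⌊ a ≟ b ⌋ then inner (t a) p q
  else reaches (t a) p ∧ reaches (t b) q ∧ link c a b

graph : Centre k → Types k n → Graph (k * n)
graph {k} {n} c t i j =
  adj c t (quotient {k} n i) (remainder {k} n i) (quotient {k} n j) (remainder {k} n j)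

-- The complement spreads along the tree: it acts on the centre node if `x` reaches its marker, and
-- then on every block whose marker is linked to that of `v`, where it acts at the marker.
stepCentre : Fin k → Fin n → Centre k → Types k n → Centre k
stepCentre v x c t = if reaches (t v) x then lcCentre v c else c

stepTypes : Fin k → Fin n → Centre k → Types k n → Types k n
stepTypes v x c t a =
  if ⌊ v ≟ a ⌋ then lcAt x (t v)
  else if reaches (t v) x ∧ link c v a then toggle (t a) else t a

inner-irrefl : (t : BlockType n) (p : Fin n) → inner t p p ≡ false
inner-irrefl clique p rewrite ⌊≟⌋-refl p = refl
inner-irrefl indep p = refl
inner-irrefl (star x) p with ⌊ x ≟ p ⌋
... | true = refl
... | false = refl

inner-sym : (t : BlockType n) (p q : Fin n) → inner t p q ≡ inner t q p
inner-sym clique p q = cong not (⌊≟⌋-sym p q)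
inner-sym indep p q = refl
inner-sym (star x) p q = xor-comm ⌊ x ≟ p ⌋ ⌊ x ≟ q ⌋

link-sym : (c : Centre k) (a b : Fin k) → link c a b ≡ link c b a
link-sym nothing a b = refl
link-sym (just r) a b with ⌊ r ≟ a ⌋ | ⌊ r ≟ b ⌋
... | true | true = refl
... | true | false = refl
... | false | true = refl
... | false | false = refl

adj-sym : (c : Centre k) (t : Types k n) (a b : Fin k) (p q : Fin n) →
  adj c t a p b q ≡ adj c t b q a p
adj-sym c t a b p q rewrite ⌊≟⌋-sym b a | link-sym c b a with a ≟ b
... | yes refl = inner-sym (t a) p q
... | no _ with reaches (t a) p | reaches (t b) q
...   | true | true = refl
...   | true | false = refl
...   | false | true = refl
...   | false | false = refl

inner-lcAt : (x : Fin n) (t : BlockType n) {p q : Fin n} → p ≢ q →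
  inner (lcAt x t) p q ≡ (inner t x p ∧ inner t x q) xor inner t p q
inner-lcAt x clique {p} {q} p≢q with x ≟ p | x ≟ q | p ≟ q
... | _ | _ | yes p≡q = contradiction p≡q p≢q
... | yes refl | yes refl | _ = contradiction refl p≢q
... | yes _ | no _ | no _ = refl
... | no _ | yes _ | no _ = refl
... | no _ | no _ | no _ = refl
inner-lcAt x indep p≢q = refl
inner-lcAt x (star y) {p} {q} p≢q with y ≟ x | y ≟ p | y ≟ q | p ≟ q in e
... | _ | _ | _ | yes p≡q = contradiction p≡q p≢q
... | _ | yes refl | yes refl | no _ = contradiction refl p≢q
... | yes refl | yes _ | no _ | no _ rewrite e = refl
... | yes refl | no _ | yes _ | no _ rewrite e = refl
... | yes refl | no _ | no _ | no _ rewrite e = refl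
... | no _ | yes yp | no yq | no _ rewrite yp | ⌊≟⌋-refl p | ⌊≟⌋-≢ p≢q = refl
... | no _ | no yp | yes refl | no _ rewrite ⌊≟⌋-refl q | ⌊≟⌋-≢ yp = refl
... | no _ | no yp | no yq | no _ rewrite ⌊≟⌋-≢ yp | ⌊≟⌋-≢ yq = refl

-- The rule of `inner-lcAt` with the marker in place of `q`, since `reaches` is adjacency to the
-- marker.
reaches-lcAt : (x : Fin n) (t : BlockType n) (p : Fin n) →
  reaches (lcAt x t) p ≡ (inner t x p ∧ reaches t x) xor reaches t p
reaches-lcAt x clique p with x ≟ p
... | yes _ = refl
... | no _ = refl
reaches-lcAt x indep p = refl
reaches-lcAt x (star y) p with y ≟ x
... | yes refl with ⌊ x ≟ p ⌋
...   | true = refl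
...   | false = refl
reaches-lcAt x (star y) p | no _ with ⌊ y ≟ p ⌋
...   | true = refl
...   | false = refl

reaches-toggle : (t : BlockType n) (p : Fin n) → reaches (toggle t) p ≡ reaches t p
reaches-toggle clique p = refl
reaches-toggle indep p = refl
reaches-toggle (star x) p = refl

reaches-toggle? : ∀ y (t : BlockType n) (p : Fin n) → reaches (if y then toggle t else t) p ≡ reaches t p
reaches-toggle? true t p = reaches-toggle t p
reaches-toggle? false t p = refl

-- The same rule once more, now complementing at the marker, whose neighbours are the vertices that
-- reach it.
inner-toggle : (t : BlockType n) {p q : Fin n} → p ≢ q →
  inner (toggle t) p q ≡ (reaches t p ∧ reaches t q) xor inner t p q
inner-toggle clique p≢q rewrite ⌊≟⌋-≢ p≢q = refl
inner-toggle indep p≢q rewrite ⌊≟⌋-≢ p≢q = refl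
inner-toggle (star x) {p} {q} p≢q with x ≟ p | x ≟ q
... | yes refl | yes refl = contradiction refl p≢q
... | yes _ | no _ = refl
... | no _ | yes _ = refl
... | no _ | no _ = refl

link-lcCentre-at : (c : Centre k) {v a : Fin k} → v ≢ a → link (lcCentre v c) v a ≡ link c v a
link-lcCentre-at nothing {v} v≢a rewrite ⌊≟⌋-refl v = refl
link-lcCentre-at (just r) {v} v≢a with ⌊ r ≟ v ⌋ in e
... | true = refl
... | false rewrite e = refl

link-lcCentre : (c : Centre k) {v a b : Fin k} → v ≢ a → v ≢ b → a ≢ b →
  link (lcCentre v c) a b ≡ (link c v a ∧ link c v b) xor link c a b
link-lcCentre nothing v≢a v≢b a≢b rewrite ⌊≟⌋-≢ v≢a | ⌊≟⌋-≢ v≢b = refl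
link-lcCentre (just r) {v} {a} {b} v≢a v≢b a≢b with r ≟ v
... | yes refl rewrite ⌊≟⌋-≢ v≢a | ⌊≟⌋-≢ v≢b = refl
... | no _ with r ≟ a | r ≟ b
...   | yes refl | yes refl = contradiction refl a≢b
...   | yes _ | no _ = refl
...   | no _ | yes _ = refl
...   | no _ | no _ = refl

private
  ∧-xor-factor : ∀ e w a b l →
    ((e ∧ w) xor a) ∧ b ∧ l ≡ (e ∧ (w ∧ b ∧ l)) xor (a ∧ b ∧ l)
  ∧-xor-factor false w a b l = refl
  ∧-xor-factor true false a b l = refl
  ∧-xor-factor true true a false l with a
  ... | true = refl
  ... | false = refl
  ∧-xor-factor true true a true false with a
  ... | true = refl
  ... | false = refl
  ∧-xor-factor true true a true true with a
  ... | true = refl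
  ... | false = refl

-- The links of `v` survive the complement and `toggle` keeps `reaches` in block `b`, so edges
-- leaving block `v` change only through `reaches-lcAt`.
adj-lc-at : (c : Centre k) (t : Types k n) {v b : Fin k} {x p q : Fin n} → v ≢ b →
  adj (stepCentre v x c t) (stepTypes v x c t) v p b q
    ≡ (adj c t v x v p ∧ adj c t v x b q) xor adj c t v p b q
adj-lc-at c t {v} {b} {x} {p} {q} v≢b
  rewrite ⌊≟⌋-≢ v≢b | ⌊≟⌋-refl v
        | reaches-lcAt x (t v) p
        | reaches-toggle? (reaches (t v) x ∧ link c v b) (t b) q
  with reaches (t v) x
... | true rewrite link-lcCentre-at c v≢b =
  ∧-xor-factor (inner (t v) x p) true (reaches (t v) p) (reaches (t b) q) (link c v b)
... | false = ∧-xor-factor (inner (t v) x p) false (reaches (t v) p) (reaches (t b) q) (link c v b)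

adj-lc-off : (c : Centre k) (t : Types k n) {v a b : Fin k} {x p q : Fin n} →
  v ≢ a → v ≢ b → a ≢ b →
  adj (stepCentre v x c t) (stepTypes v x c t) a p b q
    ≡ (adj c t v x a p ∧ adj c t v x b q) xor adj c t a p b q
adj-lc-off c t {v} {a} {b} {x} {p} {q} v≢a v≢b a≢b
  rewrite ⌊≟⌋-≢ v≢a | ⌊≟⌋-≢ v≢b | ⌊≟⌋-≢ a≢b
        | reaches-toggle? (reaches (t v) x ∧ link c v a) (t a) p
        | reaches-toggle? (reaches (t v) x ∧ link c v b) (t b) q
  with reaches (t v) x
... | false = refl
... | true rewrite link-lcCentre c v≢a v≢b a≢b with reaches (t a) p | reaches (t b) q
...   | true | true = refl
...   | false | _ = refl
...   | true | false with link c v a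
...     | true = refl
...     | false = refl

adj-lc-within : (c : Centre k) (t : Types k n) {v a : Fin k} {x p q : Fin n} → p ≢ q →
  adj (stepCentre v x c t) (stepTypes v x c t) a p a q
    ≡ (adj c t v x a p ∧ adj c t v x a q) xor adj c t a p a q
adj-lc-within c t {v} {a} {x} {p} {q} p≢q rewrite ⌊≟⌋-refl a with v ≟ a
... | yes refl = inner-lcAt x (t v) p≢q
... | no _ with reaches (t v) x | link c v a
...   | false | _ = refl
...   | true | true
        rewrite ∧-identityʳ (reaches (t a) p) | ∧-identityʳ (reaches (t a) q) = inner-toggle (t a) p≢q
...   | true | false with reaches (t a) p
...     | false = refl
...     | true with reaches (t a) q
...       | true = refl
...       | false = refl

-- Off the diagonal, adding the product of the adjacencies to `x` modulo 2 is local complementation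
-- at `x`. The cases depend on which of the blocks `v`, `a`, `b` coincide.
adj-lc : (c : Centre k) (t : Types k n) (v a b : Fin k) (x p q : Fin n) → a ≢ b ⊎ p ≢ q →
  adj (stepCentre v x c t) (stepTypes v x c t) a p b q
    ≡ (adj c t v x a p ∧ adj c t v x b q) xor adj c t a p b q
adj-lc c t v a b x p q d = go (a ≟ b) (v ≟ a) (v ≟ b) d
  where
  Goal : Fin _ → Fin _ → Fin _ → Fin _ → Set
  Goal a p b q = adj (stepCentre v x c t) (stepTypes v x c t) a p b q
    ≡ (adj c t v x a p ∧ adj c t v x b q) xor adj c t a p b q
  go : Dec (a ≡ b) → Dec (v ≡ a) → Dec (v ≡ b) → a ≢ b ⊎ p ≢ q → Goal a p b q
  go (yes a≡b) _ _ (inj₁ a≢b) = contradiction a≡b a≢b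
  go (yes refl) _ _ (inj₂ p≢q) = adj-lc-within c t {v} {a} {x} p≢q
  go (no a≢b) (yes refl) _ _ = adj-lc-at c t a≢b
  go (no a≢b) (no v≢a) (no v≢b) _ = adj-lc-off c t v≢a v≢b a≢b
  -- The complement takes place in the block of the second vertex; symmetry reduces this to
  -- `adj-lc-at`.
  go (no a≢b) (no v≢a) (yes refl) _ = begin
    adj c′ t′ a p v q
      ≡⟨ adj-sym c′ t′ a v p q ⟩
    adj c′ t′ v q a p
      ≡⟨ adj-lc-at c t v≢a ⟩
    (adj c t v x v q ∧ adj c t v x a p) xor adj c t v q a p
      ≡⟨ cong₂ _xor_ (∧-comm (adj c t v x v q) _) (adj-sym c t v a q p) ⟩
    (adj c t v x a p ∧ adj c t v x v q) xor adj c t a p v q ∎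
    where
    open ≡-Reasoning
    c′ = stepCentre v x c t
    t′ = stepTypes v x c t

adj-irrefl : (c : Centre k) (t : Types k n) (a : Fin k) (p : Fin n) → adj c t a p a p ≡ false
adj-irrefl c t a p rewrite ⌊≟⌋-refl a = inner-irrefl (t a) p

module _ {k n : ℕ} where

  block : Fin (k * n) → Fin k
  block = quotient {k} n

  pos : Fin (k * n) → Fin n
  pos = remainder {k} n

  vertex-≡ : {i j : Fin (k * n)} → block i ≡ block j → pos i ≡ pos j → i ≡ j
  vertex-≡ {i} {j} e f = trans (sym (combine-remQuot {k} n i)) (trans (cong₂ combine e f) (combine-remQuot {k} n j))

  vertex-≢ : {i j : Fin (k * n)} → i ≢ j → block i ≢ block j ⊎ pos i ≢ pos j
  vertex-≢ {i} {j} i≢j with block i ≟ block j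
  ... | no b≢ = inj₁ b≢
  ... | yes b≡ = inj₂ (i≢j ∘ vertex-≡ b≡)

  block-combine : (a : Fin k) (p : Fin n) → block (combine a p) ≡ a
  block-combine a p = cong proj₁ (remQuot-combine a p)

  pos-combine : (a : Fin k) (p : Fin n) → pos (combine a p) ≡ p
  pos-combine a p = cong proj₂ (remQuot-combine a p)

  -- On the diagonal both sides are `false`; elsewhere this is `adj-lc`, read through the pairing of
  -- block and position.
  graph-lc : (c : Centre k) (t : Types k n) (v i j : Fin (k * n)) →
    lc v (graph c t) i j
      ≡ graph (stepCentre (block v) (pos v) c t) (stepTypes (block v) (pos v) c t) i j
  graph-lc c t v i j with i ≟ j
  ... | yes refl = trans (adj-irrefl c t (block i) (pos i))
                     (sym (adj-irrefl (stepCentre (block v) (pos v) c t) (stepTypes (block v) (pos v) c t) (block i) (pos i)))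
  ... | no i≢j = trans (if-not (graph c t v i ∧ graph c t v j) (graph c t i j))
                   (sym (adj-lc c t (block v) (block i) (block j) (pos v) (pos i) (pos j) (vertex-≢ i≢j)))
    where
    if-not : ∀ y z → (if y then not z else z) ≡ y xor z
    if-not true z = refl
    if-not false z = refl

-- Counting

bit : Bool → ℕ
bit b = if b then 1 else 0

count : (Fin k → Bool) → ℕ
count {zero} f = 0
count {suc k} f = bit (f zero) + count (f ∘ suc)

count-cong : {f g : Fin k → Bool} → (∀ i → f i ≡ g i) → count f ≡ count g
count-cong {zero} e = refl
count-cong {suc k} e = cong₂ _+_ (cong bit (e zero)) (count-cong (e ∘ suc))

count-punchIn : (i : Fin (suc k)) (f : Fin (suc k) → Bool) → count f ≡ bit (f i) + count (f ∘ punchIn i)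
count-punchIn zero f = refl
count-punchIn {suc k} (suc i) f = begin
  b₀ + count (f ∘ suc)        ≡⟨ cong (b₀ +_) (count-punchIn i (f ∘ suc)) ⟩
  b₀ + (bit (f (suc i)) + c)  ≡⟨ sym (+-assoc b₀ _ c) ⟩
  b₀ + bit (f (suc i)) + c    ≡⟨ cong (_+ c) (+-comm b₀ _) ⟩
  bit (f (suc i)) + b₀ + c    ≡⟨ +-assoc (bit (f (suc i))) b₀ c ⟩
  bit (f (suc i)) + (b₀ + c)  ∎
  where
  open ≡-Reasoning
  b₀ = bit (f zero)
  c = count (f ∘ suc ∘ punchIn i)

count≤ : (f : Fin k → Bool) → count f ≤ k
count≤ {zero} f = z≤n
count≤ {suc k} f with f zero
... | true = s≤s (count≤ (f ∘ suc))
... | false = ≤-trans (count≤ (f ∘ suc)) (n≤1+n k)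

count-none : (f : Fin k → Bool) → (∀ i → f i ≡ false) → count f ≡ 0
count-none {zero} f e = refl
count-none {suc k} f e rewrite e zero = count-none (f ∘ suc) (e ∘ suc)

count-all : (f : Fin k → Bool) → (∀ i → f i ≡ true) → count f ≡ k
count-all {zero} f e = refl
count-all {suc k} f e rewrite e zero = cong suc (count-all (f ∘ suc) (e ∘ suc))

count-< : ∀ {j} → j ≤ k → count {k} (λ i → toℕ i <ᵇ j) ≡ j
count-< {k} {zero} _ = count-none (λ (_ : Fin k) → false) (λ _ → refl)
count-< {suc k} {suc j} (s≤s j≤k) = cong suc (count-< j≤k)

count-switch-on : (i : Fin k) {f g : Fin k → Bool} →
  (∀ a → a ≢ i → f a ≡ g a) → f i ≡ false → g i ≡ true → count g ≡ suc (count f)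
count-switch-on {suc k} i {f} {g} e fi gi
  rewrite count-punchIn i f | count-punchIn i g | fi | gi =
  cong suc (count-cong (λ a → sym (e (punchIn i a) (punchInᵢ≢i i a))))

-- A common value of f at 0 and g at some i exists because the counts agree; removing both points leaves equal counts.
permute-of-count : (f g : Fin k → Bool) → count f ≡ count g →
  Σ[ π ∈ Permutation k k ] (∀ i → f i ≡ g (π ⟨$⟩ʳ i))
permute-of-count {zero} f g e = id , λ ()
permute-of-count {suc k} f g e with any? (λ i → g i ≟ᵇ f zero)
... | yes (i , gi) = insert zero i π , matches
  where
  rest : count (f ∘ suc) ≡ count (g ∘ punchIn i)
  rest = +-cancelˡ-≡ (bit (f zero)) _ _
    (trans e (trans (count-punchIn i g) (cong (λ b → bit b + count (g ∘ punchIn i)) gi)))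
  π = proj₁ (permute-of-count (f ∘ suc) (g ∘ punchIn i) rest)
  matches : ∀ a → f a ≡ g (insert zero i π ⟨$⟩ʳ a)
  matches zero = sym gi
  matches (suc a) = trans (proj₂ (permute-of-count (f ∘ suc) (g ∘ punchIn i) rest) a)
    (cong g (sym (insert-punchIn zero i π a)))
... | no none with f zero
...   | true = contradiction (trans e (count-none g (λ i → ¬-not (none ∘ (i ,_))))) λ ()
...   | false = contradiction
          (≤-trans (≤-reflexive (sym (trans e (count-all g (λ i → ¬-not (none ∘ (i ,_))))))) (count≤ (f ∘ suc)))
          1+n≰n

-- A pigeonhole for a map `h` defined only where `f` holds. If `f zero` holds, its image is punched
-- out of the target, and injectivity keeps the other images off it.
count-injection : (f : Fin m → Bool) (g : Fin n → Bool)
  (h : ∀ i → f i ≡ true → Fin n) →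
  (∀ i (p : f i ≡ true) → g (h i p) ≡ true) →
  (∀ i j (p : f i ≡ true) (q : f j ≡ true) → h i p ≡ h j q → i ≡ j) →
  count f ≤ count g
count-injection {zero} f g h h-true h-inj = z≤n
count-injection {suc m} {n} f g h h-true h-inj with f zero in f₀
... | false = count-injection (f ∘ suc) g (λ i → h (suc i)) (λ i → h-true (suc i))
                (λ i j p q e → Fin-suc-injective (h-inj (suc i) (suc j) p q e))
... | true = go n g h h-true h-inj
  where
  go : ∀ n (g : Fin n → Bool) (h : ∀ i → f i ≡ true → Fin n) →
    (∀ i (p : f i ≡ true) → g (h i p) ≡ true) →
    (∀ i j (p : f i ≡ true) (q : f j ≡ true) → h i p ≡ h j q → i ≡ j) →
    suc (count (f ∘ suc)) ≤ count g
  go zero g h h-true h-inj with () ← h zero f₀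
  go (suc n) g h h-true h-inj
    rewrite count-punchIn (h zero f₀) g | h-true zero f₀ =
    s≤s (count-injection (f ∘ suc) (g ∘ punchIn h₀)
      (λ i p → punchOut (h₀≢ i p))
      (λ i p → trans (cong g (punchIn-punchOut (h₀≢ i p))) (h-true (suc i) p))
      (λ i j p q e → Fin-suc-injective (h-inj (suc i) (suc j) p q (punchOut-injective (h₀≢ i p) (h₀≢ j q) e))))
    where
    h₀ = h zero f₀
    h₀≢ : ∀ i p → h₀ ≢ h (suc i) p
    h₀≢ i p e = 0≢1+n (h-inj zero (suc i) f₀ p e)

-- Parity and halving

odd : ℕ → Bool
odd zero = false
odd (suc n) = not (odd n)

odd-double : ∀ m → odd (m + m) ≡ false
odd-double zero = refl
odd-double (suc m) rewrite +-suc m m | odd-double m = refl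

odd⇒1+double : ∀ j → odd j ≡ true → ∃[ m ] j ≡ suc (m + m)
odd⇒1+double (suc zero) _ = 0 , refl
odd⇒1+double (suc (suc j)) e with odd j in o
... | true with m , refl ← odd⇒1+double j o = suc m , cong (2 +_) (sym (+-suc m m))

-- Together with its converse below, this matches the odd numbers 2m + 1 up to `k` with the `m`
-- below `⌈ k /2⌉`, the first summand of the final count.
<⌈/2⌉⇒double< : ∀ {m k} → m < ⌈ k /2⌉ → m + m < k
<⌈/2⌉⇒double< {zero} {suc zero} _ = s≤s z≤n
<⌈/2⌉⇒double< {zero} {suc (suc k)} _ = s≤s z≤n
<⌈/2⌉⇒double< {suc m} {suc (suc k)} (s≤s m<) rewrite +-suc m m = s≤s (s≤s (<⌈/2⌉⇒double< m<))
<⌈/2⌉⇒double< {suc m} {suc zero} (s≤s ())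

double<⇒<⌈/2⌉ : ∀ {m k} → m + m < k → m < ⌈ k /2⌉
double<⇒<⌈/2⌉ {zero} {suc zero} _ = s≤s z≤n
double<⇒<⌈/2⌉ {zero} {suc (suc k)} _ = s≤s z≤n
double<⇒<⌈/2⌉ {suc m} {suc zero} (s≤s ())
double<⇒<⌈/2⌉ {suc m} {suc (suc k)} (s≤s m<) rewrite +-suc m m with s≤s m<′ ← m< = s≤s (double<⇒<⌈/2⌉ m<′)

-- The orbit of the clique-star

isStar : BlockType n → Bool
isStar clique = false
isStar indep = false
isStar (star _) = true

starCount : Types k n → ℕ
starCount t = count (isStar ∘ t)

-- The kind forced on block `r` when the centre node is a star with centre `r` and there are `j`
-- star blocks.
centreType : ℕ → BlockType n
centreType j = if odd j then indep else clique

-- Parity of the number of star blocks is the invariant cutting out the orbit among all graphs of this shape.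
Valid : Centre k → Types k n → Set
Valid nothing t = (∀ a → t a ≢ clique) × odd (starCount t) ≡ true
Valid (just r) t = (∀ a → a ≢ r → t a ≢ indep) × t r ≡ centreType (starCount t)

toggle-centreType : ∀ j → toggle (centreType {n} j) ≡ centreType (suc j)
toggle-centreType j with odd j
... | true = refl
... | false = refl

isStar-toggle : (s : BlockType n) → isStar (toggle s) ≡ isStar s
isStar-toggle clique = refl
isStar-toggle indep = refl
isStar-toggle (star _) = refl

toggle≡indep : (s : BlockType n) → toggle s ≡ indep → s ≡ clique
toggle≡indep clique _ = refl

toggle≡clique : (s : BlockType n) → toggle s ≡ clique → s ≡ indep
toggle≡clique indep _ = refl

starCount-cong : {t t′ : Types k n} → (∀ a → t a ≡ t′ a) → starCount t ≡ starCount t′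
starCount-cong e = count-cong (cong isStar ∘ e)

Valid-cong : (c : Centre k) {t t′ : Types k n} → (∀ a → t a ≡ t′ a) → Valid c t → Valid c t′
Valid-cong nothing e (ok , parity) =
  (λ a → ok a ∘ trans (e a)) , trans (cong odd (sym (starCount-cong e))) parity
Valid-cong (just r) e (ok , parity) =
  (λ a a≢r → ok a a≢r ∘ trans (e a)) ,
  trans (sym (e r)) (trans parity (cong centreType (starCount-cong e)))

module _ (v : Fin k) (x : Fin n) (c : Centre k) (t : Types k n) where

  private
    c′ = stepCentre v x c t
    t′ = stepTypes v x c t

  stepTypes-at : t′ v ≡ lcAt x (t v)
  stepTypes-at rewrite ⌊≟⌋-refl v = refl

  stepTypes-linked : ∀ {a} → v ≢ a → reaches (t v) x ≡ true → link c v a ≡ true → t′ a ≡ toggle (t a)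
  stepTypes-linked v≢a e f rewrite ⌊≟⌋-≢ v≢a | e | f = refl

  stepTypes-unlinked : ∀ {a} → v ≢ a → link c v a ≡ false → t′ a ≡ t a
  stepTypes-unlinked v≢a f rewrite ⌊≟⌋-≢ v≢a | f with reaches (t v) x
  ... | true = refl
  ... | false = refl

  -- Blocks other than `v` are at most toggled, which keeps stars; hence the star count can change
  -- only at `v`.
  isStar-stepTypes : ∀ a → a ≢ v → isStar (t a) ≡ isStar (t′ a)
  isStar-stepTypes a a≢v rewrite ⌊≟⌋-≢ (a≢v ∘ sym) with reaches (t v) x ∧ link c v a
  ... | true = sym (isStar-toggle (t a))
  ... | false = refl

  starCount-clique : t v ≡ clique → starCount t′ ≡ suc (starCount t)
  starCount-clique e = count-switch-on v isStar-stepTypes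
    (cong isStar e) (cong isStar (trans stepTypes-at (cong (lcAt x) e)))

  starCount-star : t v ≡ star x → starCount t ≡ suc (starCount t′)
  starCount-star e = count-switch-on v (λ a a≢v → sym (isStar-stepTypes a a≢v))
    (trans (cong isStar (trans stepTypes-at (cong (lcAt x) e))) not-star) (cong isStar e)
    where
    not-star : isStar (lcAt x (star x)) ≡ false
    not-star rewrite ⌊≟⌋-refl x = refl

  starCount-indep : t v ≡ indep → starCount t′ ≡ starCount t
  starCount-indep e = count-cong same
    where
    same : ∀ a → isStar (t′ a) ≡ isStar (t a)
    same a with a ≟ v
    ... | yes refl = trans (cong isStar stepTypes-at) (trans (cong (isStar ∘ lcAt x) e) (sym (cong isStar e)))
    ... | no a≢v = sym (isStar-stepTypes a a≢v)

  data Local : Set where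
    clique : t v ≡ clique → t′ v ≡ star x → Local
    indep : t v ≡ indep → t′ v ≡ indep → Local
    star : t v ≡ star x → t′ v ≡ clique → Local

  -- A vertex that does not reach its marker is a leaf of a star block. Its only neighbour is the
  -- star's centre, so complementing there changes nothing.
  local : (reaches (t v) x ≡ false × (∀ a → t a ≡ t′ a)) ⊎ (reaches (t v) x ≡ true × Local)
  local = go (t v) refl
    where
    lcAt-star : (y : Fin n) → lcAt y (star y) ≡ clique
    lcAt-star y rewrite ⌊≟⌋-refl y = refl
    go : ∀ s → t v ≡ s → (reaches (t v) x ≡ false × (∀ a → t a ≡ t′ a)) ⊎ (reaches (t v) x ≡ true × Local)
    go clique e = inj₂ (cong (λ s → reaches s x) e , clique e (trans stepTypes-at (cong (lcAt x) e)))
    go indep e = inj₂ (cong (λ s → reaches s x) e , indep e (trans stepTypes-at (cong (lcAt x) e)))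
    go (star y) e with y ≟ x
    ... | yes refl = inj₂ (trans (cong (λ s → reaches s x) e) (⌊≟⌋-refl x) ,
                       star e (trans stepTypes-at (trans (cong (lcAt x) e) (lcAt-star x))))
    ... | no y≢x = inj₁ (unreached , same)
      where
      unreached : reaches (t v) x ≡ false
      unreached = trans (cong (λ s → reaches s x) e) (⌊≟⌋-≢ y≢x)
      lcAt-other : lcAt x (star y) ≡ star y
      lcAt-other rewrite ⌊≟⌋-≢ y≢x = refl
      same : ∀ a → t a ≡ t′ a
      same a with v ≟ a
      ... | yes refl = trans e (sym (trans (cong (lcAt x) e) lcAt-other))
      ... | no v≢a rewrite unreached = refl

odd⇒indep : ∀ j → odd j ≡ true → indep ≡ centreType {n} j
odd⇒indep j e rewrite e = refl

even⇒clique : ∀ j → odd j ≡ false → clique ≡ centreType {n} j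
even⇒clique j e rewrite e = refl

indep⇒odd : ∀ j → centreType {n} j ≡ indep → odd j ≡ true
indep⇒odd j e with odd j
... | true = refl

clique⇒even : ∀ j → centreType {n} j ≡ clique → odd j ≡ false
clique⇒even j e with odd j
... | false = refl

not≡true : ∀ {b} → not b ≡ true → b ≡ false
not≡true {false} _ = refl

centreType≢star : ∀ j {x : Fin n} → star x ≢ centreType j
centreType≢star j with odd j
... | true = λ ()
... | false = λ ()

-- Every block other than `v` is toggled, so its `indep` becomes `clique`. In block `v` an `indep`
-- stays and the count stays odd, or a star becomes a clique and the count drops to an even number.
Valid-complete⇒star : (v : Fin k) (x : Fin n) (t : Types k n) → reaches (t v) x ≡ true →
  Local v x nothing t → Valid nothing t → Valid (just v) (stepTypes v x nothing t)
Valid-complete⇒star {k} {n} v x t reached loc (ok , parity) =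
  (λ a a≢v e → ok a (toggle≡indep (t a)
    (trans (sym (stepTypes-linked v x nothing t (a≢v ∘ sym) reached refl)) e))) ,
  centre loc
  where
  j′ = starCount (stepTypes v x nothing t)
  centre : Local v x nothing t → stepTypes v x nothing t v ≡ centreType j′
  centre (clique tv _) = contradiction tv (ok v)
  centre (indep tv t′v) = trans t′v (odd⇒indep j′ (trans (cong odd (starCount-indep v x nothing t tv)) parity))
  centre (star tv t′v) = trans t′v (even⇒clique j′
    (not≡true (trans (cong odd (sym (starCount-star v x nothing t tv))) parity)))

-- The other blocks are toggled and lose their cliques. By parity block `v` is a clique with an even
-- count, which becomes a star and makes the count odd, or `indep` with an odd count, which stays.
Valid-star⇒complete : (v : Fin k) (x : Fin n) (t : Types k n) → reaches (t v) x ≡ true →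
  Local v x (just v) t → Valid (just v) t → Valid nothing (stepTypes v x (just v) t)
Valid-star⇒complete {k} {n} v x t reached loc (ok , parity) =
  (λ a → no-clique a (v ≟ a) loc) , odd′ loc
  where
  t′ = stepTypes v x (just v) t
  no-clique : ∀ a → Dec (v ≡ a) → Local v x (just v) t → t′ a ≢ clique
  no-clique a (yes refl) (clique _ t′v) e = contradiction (trans (sym t′v) e) λ ()
  no-clique a (yes refl) (indep _ t′v) e = contradiction (trans (sym t′v) e) λ ()
  no-clique a (yes refl) (star tv _) e = centreType≢star (starCount t) (trans (sym tv) parity)
  no-clique a (no v≢a) _ e = ok a (v≢a ∘ sym) (toggle≡clique (t a)
    (trans (sym (stepTypes-linked v x (just v) t v≢a reached (cong (_∨ ⌊ v ≟ a ⌋) (⌊≟⌋-refl v)))) e))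
  odd′ : Local v x (just v) t → odd (starCount t′) ≡ true
  odd′ (clique tv _) = trans (cong odd (starCount-clique v x (just v) t tv))
    (cong not (clique⇒even {n} (starCount t) (trans (sym parity) tv)))
  odd′ (indep tv _) = trans (cong odd (starCount-indep v x (just v) t tv))
    (indep⇒odd {n} (starCount t) (trans (sym parity) tv))
  odd′ (star tv _) = contradiction (trans (sym tv) parity) (centreType≢star (starCount t))

-- Only block `r` is linked to `v`, and it is toggled; block `v` switches between clique and star,
-- so the count moves by one and `centreType` toggles as well.
Valid-star⇒star : (v r : Fin k) (x : Fin n) (t : Types k n) → r ≢ v → reaches (t v) x ≡ true →
  Local v x (just r) t → Valid (just r) t → Valid (just r) (stepTypes v x (just r) t)
Valid-star⇒star {k} {n} v r x t r≢v reached loc (ok , parity) =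
  (λ a → no-indep a (v ≟ a) loc) , trans t′r (centre loc)
  where
  t′ = stepTypes v x (just r) t
  t′r : t′ r ≡ centreType (suc (starCount t))
  t′r = trans (stepTypes-linked v x (just r) t (r≢v ∘ sym) reached
          (trans (cong (⌊ r ≟ v ⌋ ∨_) (⌊≟⌋-refl r)) (∨-zeroʳ _)))
        (trans (cong toggle parity) (toggle-centreType (starCount t)))
  centre : Local v x (just r) t → centreType {n} (suc (starCount t)) ≡ centreType (starCount t′)
  centre (clique tv _) = cong centreType (sym (starCount-clique v x (just r) t tv))
  centre (indep tv _) = contradiction tv (ok v (r≢v ∘ sym))
  centre (star tv _) = trans (cong (centreType ∘ suc) (starCount-star v x (just r) t tv))
    (double-suc (starCount t′))
    where
    double-suc : ∀ j → centreType {n} (suc (suc j)) ≡ centreType j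
    double-suc j with odd j
    ... | true = refl
    ... | false = refl
  no-indep : ∀ a → Dec (v ≡ a) → Local v x (just r) t → a ≢ r → t′ a ≢ indep
  no-indep a (yes refl) (clique _ t′v) _ e = contradiction (trans (sym t′v) e) λ ()
  no-indep a (yes refl) (indep tv _) a≢r e = ok v a≢r tv
  no-indep a (yes refl) (star _ t′v) _ e = contradiction (trans (sym t′v) e) λ ()
  no-indep a (no v≢a) _ a≢r e = ok a a≢r (trans (sym (stepTypes-unlinked v x (just r) t v≢a
    (cong₂ _∨_ (⌊≟⌋-≢ r≢v) (⌊≟⌋-≢ (a≢r ∘ sym))))) e)

Valid-lc : (v : Fin k) (x : Fin n) (c : Centre k) (t : Types k n) → reaches (t v) x ≡ true →
  Local v x c t → Valid c t → Valid (lcCentre v c) (stepTypes v x c t)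
Valid-lc v x nothing t = Valid-complete⇒star v x t
Valid-lc v x (just r) t reached loc valid = go (r ≟ v)
  where
  t′ = stepTypes v x (just r) t
  as-if : ∀ {b} → ⌊ r ≟ v ⌋ ≡ b → Valid (if b then nothing else just r) t′ → Valid (lcCentre v (just r)) t′
  as-if e = subst (λ b → Valid (if b then nothing else just r) t′) (sym e)
  go : Dec (r ≡ v) → Valid (lcCentre v (just r)) t′
  go (yes refl) = as-if (⌊≟⌋-refl v) (Valid-star⇒complete v x t reached loc valid)
  go (no r≢v) = as-if (⌊≟⌋-≢ r≢v) (Valid-star⇒star v r x t r≢v reached loc valid)

Valid-step : (v : Fin k) (x : Fin n) (c : Centre k) (t : Types k n) →
  Valid c t → Valid (stepCentre v x c t) (stepTypes v x c t)
Valid-step v x c t valid with local v x c t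
... | inj₁ (unreached , same) =
  subst (λ b → Valid (if b then lcCentre v c else c) (stepTypes v x c t)) (sym unreached) (Valid-cong c same valid)
... | inj₂ (reached , loc) =
  subst (λ b → Valid (if b then lcCentre v c else c) (stepTypes v x c t)) (sym reached) (Valid-lc v x c t reached loc valid)

-- Sequences of local complements

lc-cong : ∀ {N} {A B : Graph N} (v : Fin N) → (∀ i j → A i j ≡ B i j) → ∀ i j → lc v A i j ≡ lc v B i j
lc-cong v e i j rewrite e v i | e v j | e i j = refl

lcSeq-cong : ∀ {N} {A B : Graph N} (vs : List (Fin N)) → (∀ i j → A i j ≡ B i j) →
  ∀ i j → lcSeq vs A i j ≡ lcSeq vs B i j
lcSeq-cong [] e = e
lcSeq-cong (v ∷ vs) e = lcSeq-cong vs (lc-cong v e)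

-- `lcSeq` applies the head of the list first, so a further step from an orbit member is appended at
-- the end.
lcSeq-∷ʳ : ∀ {N} (vs : List (Fin N)) (v : Fin N) (A : Graph N) → lcSeq (vs ∷ʳ v) A ≡ lc v (lcSeq vs A)
lcSeq-∷ʳ [] v A = refl
lcSeq-∷ʳ (w ∷ vs) v A = lcSeq-∷ʳ vs v (lc w A)

graph-cong : (c : Centre k) {t t′ : Types k n} → (∀ a → t a ≡ t′ a) →
  ∀ i j → graph c t i j ≡ graph c t′ i j
graph-cong {k} {n} c e i j rewrite e (quotient {k} n i) | e (quotient {k} n j) = refl

-- Each step leads to a new valid tree, so the induction runs over all of them. This confines the
-- orbit to the graphs of valid trees.
lcSeq-graph : (vs : List (Fin (k * n))) (c : Centre k) (t : Types k n) → Valid c t →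
  Σ[ c′ ∈ Centre k ] Σ[ t′ ∈ Types k n ] Valid c′ t′ × (∀ i j → lcSeq vs (graph c t) i j ≡ graph c′ t′ i j)
lcSeq-graph {k} {n} [] c t valid = c , t , valid , λ _ _ → refl
lcSeq-graph {k} {n} (v ∷ vs) c t valid
  with c′ , t′ , valid′ , e ← lcSeq-graph vs _ _ (Valid-step (block {k} {n} v) (pos {k} v) c t valid) =
  c′ , t′ , valid′ , λ i j → trans (lcSeq-cong vs (graph-lc c t v) i j) (e i j)

-- A data type rather than a function, so that c and t can be inferred.
data Reachable (G : Graph (k * n)) (c : Centre k) (t : Types k n) : Set where
  reachable : InOrbit G (graph c t) → Reachable G c t

Reachable-lc : {G : Graph (k * n)} {c c′ : Centre k} {t t′ : Types k n} (a : Fin k) (x : Fin n) →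
  stepCentre a x c t ≡ c′ → (∀ b → stepTypes a x c t b ≡ t′ b) →
  Reachable G c t → Reachable G c′ t′
Reachable-lc {k} {n} {G} {c} {_} {t} {t′} a x refl e (reachable (vs , eq)) = reachable (vs ∷ʳ v , λ i j → begin
  lcSeq (vs ∷ʳ v) G i j
    ≡⟨ cong (λ A → A i j) (lcSeq-∷ʳ vs v G) ⟩
  lc v (lcSeq vs G) i j
    ≡⟨ lc-cong v eq i j ⟩
  lc v (graph c t) i j
    ≡⟨ graph-lc c t v i j ⟩
  graph (stepCentre (block {k} {n} v) (pos {k} v) c t) (stepTypes (block {k} {n} v) (pos {k} v) c t) i j
    ≡⟨ cong₂ (λ b y → graph (stepCentre b y c t) (stepTypes b y c t) i j) (block-combine a x) (pos-combine a x) ⟩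
  graph (stepCentre a x c t) (stepTypes a x c t) i j
    ≡⟨ graph-cong (stepCentre a x c t) e i j ⟩
  graph (stepCentre a x c t) t′ i j ∎)
  where
  open ≡-Reasoning
  v = combine a x

Reachable-cong : {G : Graph (k * n)} {c : Centre k} {t t′ : Types k n} → (∀ a → t a ≡ t′ a) →
  Reachable G c t → Reachable G c t′
Reachable-cong {c = c} e (reachable (vs , eq)) = reachable (vs , λ i j → trans (eq i j) (graph-cong c e i j))

cliqueStar-graph : (r : Fin k) (i j : Fin (k * n)) →
  cliqueStar k n r i j ≡ graph (just r) (λ _ → clique) i j
cliqueStar-graph {k} {n} r i j with quotient {k} n i ≟ quotient {k} n j | i ≟ j
... | yes _ | yes refl rewrite ⌊≟⌋-refl (remainder {k} n i) = refl
... | yes e | no i≢j = cong not (sym (⌊≟⌋-≢ (i≢j ∘ vertex-≡ e)))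
... | no i≢i | yes refl = contradiction refl i≢i
... | no _ | no _ = cong₂ _∨_ (⌊≟⌋-sym (quotient {k} n i) r) (⌊≟⌋-sym (quotient {k} n j) r)

Valid-cliqueStar : (r : Fin k) → Valid {n = n} (just r) (λ _ → clique)
Valid-cliqueStar {k} r rewrite count-none {k} (λ _ → false) (λ _ → refl) = (λ _ _ ()) , refl

-- Normal forms and how they are reached

<ᵇ-true : ∀ {a b} → a < b → (a <ᵇ b) ≡ true
<ᵇ-true (s≤s z≤n) = refl
<ᵇ-true (s≤s (s≤s p)) = <ᵇ-true (s≤s p)

n<ᵇn : ∀ a → (a <ᵇ a) ≡ false
n<ᵇn zero = refl
n<ᵇn (suc a) = n<ᵇn a

<ᵇ-suc : ∀ {a} j → a ≢ j → (a <ᵇ suc j) ≡ (a <ᵇ j)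
<ᵇ-suc {zero} zero a≢j = contradiction refl a≢j
<ᵇ-suc {zero} (suc j) _ = refl
<ᵇ-suc {suc a} zero _ = refl
<ᵇ-suc {suc a} (suc j) a≢j = <ᵇ-suc j (a≢j ∘ cong suc)

-- Normal form for a star centre node: putting its centre at block `zero` and the star blocks first
-- among the others loses nothing up to isomorphism.
starTypes : ℕ → Types (suc k) (suc n)
starTypes j zero = centreType j
starTypes j (suc b) = if toℕ b <ᵇ j then star zero else clique

-- Normal form for a complete centre node. Block `zero` is a star as well, so there are `suc j` star
-- blocks and a valid tree needs `j` even.
completeTypes : ℕ → Types (suc k) (suc n)
completeTypes j zero = star zero
completeTypes j (suc b) = if toℕ b <ᵇ j then star zero else indep

isStar-if : ∀ b (s : BlockType n) (x : Fin n) → isStar s ≡ false → isStar (if b then star x else s) ≡ b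
isStar-if true s x e = refl
isStar-if false s x e = e

isStar-centreType : ∀ j → isStar (centreType {n} j) ≡ false
isStar-centreType j with odd j
... | true = refl
... | false = refl

starCount-starTypes : ∀ {k n j} → j ≤ k → starCount (starTypes {k} {n} j) ≡ j
starCount-starTypes {k} {n} {j} j≤k rewrite isStar-centreType {suc n} j =
  trans (count-cong (λ (b : Fin k) → isStar-if (toℕ b <ᵇ j) (clique {suc n}) zero refl)) (count-< j≤k)

starCount-completeTypes : ∀ {k n j} → j ≤ k → starCount (completeTypes {k} {n} j) ≡ suc j
starCount-completeTypes {k} {n} {j} j≤k =
  cong suc (trans (count-cong (λ (b : Fin k) → isStar-if (toℕ b <ᵇ j) (indep {suc n}) zero refl)) (count-< j≤k))

Valid-starTypes : ∀ {k n j} → j ≤ k → Valid (just zero) (starTypes {k} {n} j)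
Valid-starTypes {k} {n} {j} j≤k = no-indep , cong centreType (sym (starCount-starTypes {k} {n} j≤k))
  where
  no-indep : ∀ a → a ≢ zero → starTypes {k} {n} j a ≢ indep
  no-indep zero a≢0 = contradiction refl a≢0
  no-indep (suc b) _ e with toℕ b <ᵇ j
  no-indep (suc b) _ () | true
  no-indep (suc b) _ () | false

Valid-completeTypes : ∀ {k n m} → m + m ≤ k → Valid nothing (completeTypes {k} {n} (m + m))
Valid-completeTypes {k} {n} {m} j≤k =
  no-clique , trans (cong odd (starCount-completeTypes {k} {n} j≤k)) (cong not (odd-double m))
  where
  no-clique : ∀ a → completeTypes {k} {n} (m + m) a ≢ clique
  no-clique zero ()
  no-clique (suc b) e with toℕ b <ᵇ m + m
  no-clique (suc b) () | true
  no-clique (suc b) () | false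

module _ {k n : ℕ} (r : Fin (suc k)) where

  private
    Reached : Centre (suc k) → Types (suc k) (suc n) → Set
    Reached = Reachable (cliqueStar (suc k) (suc n) r)

  -- Pivoting along an edge between the blocks r and 0 moves the centre.
  cliqueStar-zero : Reached (just zero) (λ _ → clique)
  cliqueStar-zero = go r refl
    where
    start : Reached (just r) (λ _ → clique)
    start = reachable ([] , cliqueStar-graph r)
    go : (s : Fin (suc k)) → r ≡ s → Reached (just zero) (λ _ → clique)
    go zero refl = start
    go (suc s) refl =
      -- Read from the inside: complements in the blocks `suc s`, `zero` and `suc s` take the centre
      -- node to complete, then to the star at `zero`, and finally restore all cliques.
      Reachable-lc {c = just zero} (suc s) zero centre₃ types₃
        (Reachable-lc {c = nothing} zero zero refl types₂
          (Reachable-lc {t′ = t₁} (suc s) zero centre₁ types₁ start))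
      where
      t₁ t₂ : Types (suc k) (suc n)
      t₁ a = if ⌊ suc s ≟ a ⌋ then star zero else indep
      t₂ zero = indep
      t₂ (suc a) = if ⌊ suc s ≟ suc a ⌋ then star zero else clique
      centre₁ : stepCentre (suc s) (zero {n}) (just (suc s)) (λ _ → clique) ≡ nothing
      centre₁ rewrite ⌊≟⌋-refl (suc s) = refl
      types₁ : ∀ a → stepTypes (suc s) zero (just (suc s)) (λ _ → clique) a ≡ t₁ a
      types₁ a rewrite ⌊≟⌋-refl (suc s) = refl
      types₂ : ∀ a → stepTypes zero zero nothing t₁ a ≡ t₂ a
      types₂ zero = refl
      types₂ (suc a) with suc s ≟ suc a
      ... | yes _ = refl
      ... | no _ = refl
      centre₃ : stepCentre (suc s) zero (just zero) t₂ ≡ just zero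
      centre₃ rewrite ⌊≟⌋-refl (suc s) = refl
      types₃ : ∀ a → stepTypes (suc s) zero (just zero) t₂ a ≡ clique
      types₃ zero rewrite ⌊≟⌋-refl (suc s) = refl
      types₃ (suc a) with suc s ≟ suc a
      ... | yes refl rewrite ⌊≟⌋-refl (suc s) = refl
      ... | no s≢a rewrite ⌊≟⌋-refl (suc s) = refl

  -- Complementing in the first clique after the star blocks turns it into a star; block `zero` is
  -- toggled along with it, as the parity of `j` requires.
  reach-starTypes : ∀ {j} → j ≤ k → Reached (just zero) (starTypes j)
  reach-starTypes {zero} _ = Reachable-cong types cliqueStar-zero
    where
    types : ∀ a → clique ≡ starTypes zero a
    types zero = refl
    types (suc a) = refl
  reach-starTypes {suc j} j<k =
    Reachable-lc (suc b) zero centre types (reach-starTypes (<⇒≤ j<k))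
    where
    b = fromℕ< j<k
    tb : starTypes {k} {n} j (suc b) ≡ clique
    tb rewrite toℕ-fromℕ< j<k | n<ᵇn j = refl
    centre : stepCentre (suc b) zero (just zero) (starTypes {k} {n} j) ≡ just zero
    centre rewrite tb = refl
    types : ∀ a → stepTypes (suc b) zero (just zero) (starTypes {k} {n} j) a ≡ starTypes (suc j) a
    types zero rewrite tb = toggle-centreType j
    types (suc a) = at (b ≟ a)
      where
      if-star : Bool → BlockType (suc n)
      if-star y = if y then star zero else clique
      at : Dec (b ≡ a) → stepTypes (suc b) zero (just zero) (starTypes {k} {n} j) (suc a) ≡ if-star (toℕ a <ᵇ suc j)
      at (yes refl) = trans (stepTypes-at (suc b) zero (just zero) (starTypes {k} {n} j))
        (trans (cong (lcAt zero) tb) (sym (cong if-star (<ᵇ-true {toℕ b} (s≤s (≤-reflexive (toℕ-fromℕ< j<k)))))))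
      at (no b≢a) = trans
        (stepTypes-unlinked (suc b) zero (just zero) (starTypes {k} {n} j) (b≢a ∘ Fin-suc-injective) refl)
        (cong if-star (sym (<ᵇ-suc j (λ a≡j → b≢a (toℕ-injective (trans (toℕ-fromℕ< j<k) (sym a≡j)))))))

  -- An even count leaves block `zero` a clique; one complement there makes it a star, the other
  -- cliques `indep` and the centre node complete.
  reach-completeTypes : ∀ {m} → m + m ≤ k → Reached nothing (completeTypes (m + m))
  reach-completeTypes {m} j≤k = Reachable-lc zero zero centre types (reach-starTypes j≤k)
    where
    t₀ : starTypes {k} {n} (m + m) zero ≡ clique
    t₀ rewrite odd-double m = refl
    centre : stepCentre zero zero (just zero) (starTypes {k} {n} (m + m)) ≡ nothing
    centre rewrite t₀ = refl
    types : ∀ a → stepTypes zero zero (just zero) (starTypes {k} {n} (m + m)) a ≡ completeTypes (m + m) a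
    types zero rewrite t₀ = refl
    types (suc a) rewrite t₀ with toℕ a <ᵇ m + m
    ... | true = refl
    ... | false = refl

-- Isomorphism classes

⌊≟⌋-perm : (π : Permutation n n) (p q : Fin n) → ⌊ p ≟ q ⌋ ≡ ⌊ π ⟨$⟩ʳ p ≟ π ⟨$⟩ʳ q ⌋
⌊≟⌋-perm π p q with p ≟ q
... | yes refl = sym (⌊≟⌋-refl (π ⟨$⟩ʳ p))
... | no p≢q = sym (⌊≟⌋-≢ (p≢q ∘ Injection.injective (↔⇒↣ π)))

transpose-matchˡ : (x y : Fin n) → transpose x y ⟨$⟩ʳ x ≡ y
transpose-matchˡ x y with x ≟ x
... | yes _ = refl
... | no x≢x = contradiction refl x≢x

-- The centre of a star is forgotten, since a permutation of the block can move it.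
data _~_ {n : ℕ} : BlockType n → BlockType n → Set where
  clique : clique ~ clique
  indep : indep ~ indep
  star : ∀ {x y} → star x ~ star y

relabel : {s s′ : BlockType n} → s ~ s′ → Permutation n n
relabel clique = id
relabel indep = id
relabel (star {x} {y}) = transpose x y

⌊≟⌋-transpose : (x y p : Fin n) → ⌊ x ≟ p ⌋ ≡ ⌊ y ≟ transpose x y ⟨$⟩ʳ p ⌋
⌊≟⌋-transpose x y p = trans (⌊≟⌋-perm (transpose x y) x p)
  (cong (λ z → ⌊ z ≟ transpose x y ⟨$⟩ʳ p ⌋) (transpose-matchˡ x y))

reaches-relabel : {s s′ : BlockType n} (m : s ~ s′) (p : Fin n) → reaches s p ≡ reaches s′ (relabel m ⟨$⟩ʳ p)
reaches-relabel clique p = refl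
reaches-relabel indep p = refl
reaches-relabel (star {x} {y}) p = ⌊≟⌋-transpose x y p

inner-relabel : {s s′ : BlockType n} (m : s ~ s′) (p q : Fin n) →
  inner s p q ≡ inner s′ (relabel m ⟨$⟩ʳ p) (relabel m ⟨$⟩ʳ q)
inner-relabel clique p q = refl
inner-relabel indep p q = refl
inner-relabel (star {x} {y}) p q = cong₂ _xor_ (⌊≟⌋-transpose x y p) (⌊≟⌋-transpose x y q)

graph-combine : (c : Centre k) (t : Types k n) (a b : Fin k) (p q : Fin n) →
  graph c t (combine a p) (combine b q) ≡ adj c t a p b q
graph-combine c t a b p q
  rewrite block-combine a p | pos-combine a p | block-combine b q | pos-combine b q = refl

-- The vertex map permutes the blocks by `π` and the positions inside each block by `relabel`; `*↔×`
-- carries it over from pairs to vertices.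
graph-iso : (c c′ : Centre k) (t t′ : Types k n) (π : Permutation k k) →
  (∀ a b → link c a b ≡ link c′ (π ⟨$⟩ʳ a) (π ⟨$⟩ʳ b)) →
  (∀ a → t a ~ t′ (π ⟨$⟩ʳ a)) →
  Iso (graph c t) (graph c′ t′)
graph-iso {k} {n} c c′ t t′ π links types =
  ↔-trans (*↔× {k} {n}) (↔-trans (Σ-↔ π (λ {a} → relabel (types a))) (↔-sym (*↔× {k} {n}))) ,
  λ i j → trans (adj-relabel (block {k} {n} i) (block {k} {n} j) (pos {k} i) (pos {k} j))
            (sym (graph-combine c′ t′ (π ⟨$⟩ʳ block {k} {n} i) (π ⟨$⟩ʳ block {k} {n} j) _ _))
  where
  adj-relabel : ∀ a b p q → adj c t a p b q ≡
    adj c′ t′ (π ⟨$⟩ʳ a) (relabel (types a) ⟨$⟩ʳ p) (π ⟨$⟩ʳ b) (relabel (types b) ⟨$⟩ʳ q)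
  adj-relabel a b p q rewrite sym (⌊≟⌋-perm π a b) with a ≟ b
  ... | yes refl = inner-relabel (types a) p q
  ... | no _ = cong₂ _∧_ (reaches-relabel (types a) p) (cong₂ _∧_ (reaches-relabel (types b) q) (links a b))

-- Outside the centre block validity rules out either `clique` or `indep` throughout, so being a
-- star or not decides the kind.
match : (s s′ : BlockType n) → isStar s ≡ isStar s′ →
  (s ≡ clique → s′ ≢ indep) → (s ≡ indep → s′ ≢ clique) → s ~ s′
match clique clique e f g = clique
match clique indep e f g = contradiction refl (f refl)
match indep indep e f g = indep
match indep clique e f g = contradiction refl (g refl)
match (star x) (star y) e f g = star
match clique (star _) ()
match indep (star _) ()
match (star _) clique ()
match (star _) indep ()

~-reflexive : {s s′ : BlockType n} → s ≡ s′ → s ~ s′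
~-reflexive {s = clique} refl = clique
~-reflexive {s = indep} refl = indep
~-reflexive {s = star x} refl = star

complete-iso : (t t′ : Types k n) → Valid nothing t → Valid nothing t′ → starCount t ≡ starCount t′ →
  Iso (graph nothing t) (graph nothing t′)
complete-iso t t′ (ok , _) (ok′ , _) e
  with π , same ← permute-of-count (isStar ∘ t) (isStar ∘ t′) e =
  graph-iso nothing nothing t t′ π (λ _ _ → refl) (λ a → match _ _ (same a) (λ f _ → ok a f) (λ _ → ok′ _))

-- Block `r` is never a star, because `centreType` gives only `clique` or `indep`. This later bounds
-- the count by the number of the other blocks.
starCount-rest : (r : Fin (suc k)) (t : Types (suc k) n) → t r ≡ centreType (starCount t) →
  starCount t ≡ starCount (t ∘ punchIn r)
starCount-rest r t f = trans (count-punchIn r (isStar ∘ t))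
  (cong (λ b → bit b + starCount (t ∘ punchIn r)) (trans (cong isStar f) (isStar-centreType (starCount t))))

-- The permutation has to send `r` to `r′`, so it is built on the other blocks, whose star counts
-- agree, and extended by `insert`. The two centre blocks agree by parity.
star-iso : (r r′ : Fin (suc k)) (t t′ : Types (suc k) n) → Valid (just r) t → Valid (just r′) t′ →
  starCount t ≡ starCount t′ → Iso (graph (just r) t) (graph (just r′) t′)
star-iso {k} {n} r r′ t t′ (ok , parity) (ok′ , parity′) e =
  graph-iso (just r) (just r′) t t′ π links (λ a → types a (r ≟ a))
  where
  centre : t r ≡ t′ r′
  centre = trans parity (trans (cong centreType e) (sym parity′))
  rest : starCount (t ∘ punchIn r) ≡ starCount (t′ ∘ punchIn r′)
  rest = trans (sym (starCount-rest r t parity)) (trans e (starCount-rest r′ t′ parity′))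
  π₀ = proj₁ (permute-of-count _ _ rest)
  π = insert r r′ π₀
  πr : π ⟨$⟩ʳ r ≡ r′
  πr with r ≟ r
  ... | yes _ = refl
  ... | no r≢r = contradiction refl r≢r
  ⌊≟⌋-centre : ∀ a → ⌊ r ≟ a ⌋ ≡ ⌊ r′ ≟ π ⟨$⟩ʳ a ⌋
  ⌊≟⌋-centre a = trans (⌊≟⌋-perm π r a) (cong (λ s → ⌊ s ≟ π ⟨$⟩ʳ a ⌋) πr)
  links : ∀ a b → link (just r) a b ≡ link (just r′) (π ⟨$⟩ʳ a) (π ⟨$⟩ʳ b)
  links a b = cong₂ _∨_ (⌊≟⌋-centre a) (⌊≟⌋-centre b)
  types : ∀ a → Dec (r ≡ a) → t a ~ t′ (π ⟨$⟩ʳ a)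
  types a (yes refl) = ~-reflexive (trans centre (sym (cong t′ πr)))
  types a (no r≢a) = subst (λ b → t b ~ t′ (π ⟨$⟩ʳ b)) (punchIn-punchOut r≢a)
    (subst (λ b → t (punchIn r a₀) ~ t′ b) (sym (insert-punchIn r r′ π₀ a₀))
      (match _ _ (proj₂ (permute-of-count _ _ rest) a₀)
        (λ _ → ok′ _ (punchInᵢ≢i r′ (π₀ ⟨$⟩ʳ a₀)))
        (λ f _ → ok _ (punchInᵢ≢i r a₀) f)))
    where a₀ = punchOut r≢a

-- Star blocks counted by support vertices

Iso-sym : {A B : Graph N} → Iso A B → Iso B A
Iso-sym {B = B} (σ , e) = ↔-sym σ , λ i j →
  sym (trans (e _ _) (cong₂ B (Inverse.strictlyInverseˡ σ i) (Inverse.strictlyInverseˡ σ j)))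

-- A support vertex in the usual sense: `w` is a pendant vertex attached to `u`.
Support : Graph N → Fin N → Set
Support A u = ∃[ w ] A w u ≡ true × (∀ z → A w z ≡ true → z ≡ u)

Support-iso : {A B : Graph N} (iso : Iso A B) {u : Fin N} → Support A u → Support B (Inverse.to (proj₁ iso) u)
Support-iso {A = A} {B} iso@(σ , e) {u} (w , adjacent , pendant) =
  to w , trans (sym (e w u)) adjacent , λ z f →
    trans (sym (Inverse.strictlyInverseˡ σ z))
      (cong to (pendant (from z) (trans (e w (from z)) (trans (cong (B (to w)) (Inverse.strictlyInverseˡ σ z)) f))))
  where open Inverse σ using (to; from)

other : (a : Fin (suc (suc k))) → ∃[ b ] a ≢ b
other zero = suc zero , λ ()
other (suc a) = zero , λ ()

two-others : (a : Fin (suc (suc (suc k)))) → ∃[ b ] ∃[ d ] a ≢ b × a ≢ d × b ≢ d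
two-others zero = suc zero , suc (suc zero) , (λ ()) , (λ ()) , λ ()
two-others (suc zero) = zero , suc (suc zero) , (λ ()) , (λ ()) , λ ()
two-others (suc (suc a)) = zero , suc zero , (λ ()) , (λ ()) , λ ()

reached-vertex : (s : BlockType (suc n)) → ∃[ y ] reaches s y ≡ true
reached-vertex clique = zero , refl
reached-vertex indep = zero , refl
reached-vertex (star x) = x , ⌊≟⌋-refl x

linked-block : (c : Centre (suc (suc k))) (a : Fin (suc (suc k))) → ∃[ b ] a ≢ b × link c a b ≡ true
linked-block nothing a with b , a≢b ← other a = b , a≢b , refl
linked-block (just r) a with r ≟ a
... | no r≢a = r , r≢a ∘ sym , ⌊≟⌋-refl r
... | yes refl with b , a≢b ← other a = b , a≢b , refl

-- With a star centre node the only block that may be `indep` is the centre block, which is linked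
-- to all others.
indep-linked : (c : Centre k) (t : Types k n) → Valid c t → ∀ {a} → t a ≡ indep → ∀ b → link c a b ≡ true
indep-linked nothing t _ _ b = refl
indep-linked (just r) t (ok , _) {a} ta b with r ≟ a
... | yes _ = refl
... | no r≢a = contradiction ta (ok a (r≢a ∘ sym))

adj-≡ : (c : Centre k) (t : Types k n) (a : Fin k) (p q : Fin n) → adj c t a p a q ≡ inner (t a) p q
adj-≡ c t a p q rewrite ⌊≟⌋-refl a = refl

adj-≢ : (c : Centre k) (t : Types k n) {a b : Fin k} {p q : Fin n} → a ≢ b →
  adj c t a p b q ≡ reaches (t a) p ∧ reaches (t b) q ∧ link c a b
adj-≢ c t a≢b rewrite ⌊≟⌋-≢ a≢b = refl

combine-≢ˡ : {a b : Fin k} {p q : Fin n} → a ≢ b → combine a p ≢ combine b q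
combine-≢ˡ {a = a} {b} {p} {q} a≢b e = a≢b (combine-injectiveˡ a p b q e)

combine-≢ʳ : {a b : Fin k} {p q : Fin n} → p ≢ q → combine a p ≢ combine b q
combine-≢ʳ {a = a} {b} {p} {q} p≢q e = p≢q (combine-injectiveʳ a p b q e)

graph-to : (c : Centre k) (t : Types k n) (w : Fin (k * n)) (b : Fin k) (q : Fin n) →
  graph c t w (combine b q) ≡ adj c t (block {k} {n} w) (pos {k} w) b q
graph-to c t w b q rewrite block-combine b q | pos-combine b q = refl

-- A vertex of a star block other than the star's centre does not reach the marker, so it has no
-- neighbour outside the block.
leaf-neighbour : (c : Centre k) (t : Types k n) {w z : Fin (k * n)} {x : Fin n} →
  t (block {k} {n} w) ≡ star x → x ≢ pos {k} w → graph c t w z ≡ true → z ≡ combine (block {k} {n} w) x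
leaf-neighbour {k} {n} c t {w} {z} {x} tw x≢w f = go (block {k} {n} w ≟ block {k} {n} z)
  where
  a = block {k} {n} w
  p = pos {k} {n} w
  q = pos {k} {n} z
  go : Dec (a ≡ block {k} {n} z) → z ≡ combine a x
  go (yes e) = vertex-≡ {k} {n} (trans (sym e) (sym (block-combine a x)))
    (trans (sym (⌊≟⌋⇒≡ x≟q)) (sym (pos-combine a x)))
    where
    open ≡-Reasoning
    x≟q : ⌊ x ≟ q ⌋ ≡ true
    x≟q = begin
      ⌊ x ≟ q ⌋                            ≡⟨ cong (_xor ⌊ x ≟ q ⌋) (⌊≟⌋-≢ x≢w) ⟨
      inner (star x) p q                   ≡⟨ cong (λ s → inner s p q) tw ⟨
      inner (t a) p q                      ≡⟨ adj-≡ c t a p q ⟨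
      adj c t a p a q                      ≡⟨ cong (λ b → adj c t a p b q) e ⟩
      adj c t a p (block {k} {n} z) q      ≡⟨ f ⟩
      true                                 ∎
  go (no a≢) with () ← trans (sym f) (trans (adj-≢ c t a≢)
    (cong (_∧ (reaches (t (block {k} {n} z)) q ∧ link c a (block {k} {n} z)))
      (trans (cong (λ s → reaches s p) tw) (⌊≟⌋-≢ x≢w))))

-- Blocks have at least two vertices, so the star has a leaf, and this leaf is pendant.
star⇒Support : (c : Centre k) (t : Types k (2 + n)) {a : Fin k} {x : Fin (2 + n)} →
  t a ≡ star x → Support (graph c t) (combine a x)
star⇒Support {k} {n} c t {a} {x} ta with p , x≢p ← other x =
  combine a p ,
  trans (graph-combine c t a a p x) (trans (adj-≡ c t a p x) (trans (cong (λ s → inner s p x) ta)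
    (cong₂ _xor_ (⌊≟⌋-≢ x≢p) (⌊≟⌋-refl x)))) ,
  λ z f → trans
    (leaf-neighbour c t {w = combine a p} {z} (trans (cong t (block-combine a p)) ta)
      (λ e → x≢p (trans e (pos-combine a p))) f)
    (cong (λ b → combine b x) (block-combine a p))

module _ {k n : ℕ} (c : Centre (3 + k)) (t : Types (3 + k) (2 + n)) (valid : Valid c t) where

  private
    V = Fin ((3 + k) * (2 + n))
    A : Graph ((3 + k) * (2 + n))
    A = graph c t
    blk : V → Fin (3 + k)
    blk = block {3 + k} {2 + n}

  outer-neighbour : ∀ w b → blk w ≢ b → reaches (t (blk w)) (pos {3 + k} w) ≡ true → link c (blk w) b ≡ true →
    ∃[ y ] A w (combine b y) ≡ true
  outer-neighbour w b w≢b reached linked with y , f ← reached-vertex (t b) =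
    y , trans (graph-to c t w b y) (trans (adj-≢ c t w≢b) (cong₂ _∧_ reached (cong₂ _∧_ f linked)))

  inner-neighbour : ∀ w q → inner (t (blk w)) (pos {3 + k} w) q ≡ true → A w (combine (blk w) q) ≡ true
  inner-neighbour w q f = trans (graph-to c t w (blk w) q) (trans (adj-≡ c t (blk w) _ q) f)

  -- The pendant vertex `w` must be a leaf of a star block, as it has two neighbours otherwise: in a
  -- clique or as the centre of a star, one inside its block and one outside; in an `indep` block,
  -- one in each of two other blocks.
  Support⇒star : ∀ u → Support A u → t (blk u) ≡ star (pos {3 + k} u)
  Support⇒star u (w , _ , pendant) = cases (t a) refl
    where
    a = blk w
    p = pos {3 + k} {2 + n} w
    twofold : ∀ {y z} → A w y ≡ true → A w z ≡ true → y ≡ z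
    twofold f g = trans (pendant _ f) (sym (pendant _ g))
    not-clique-like : ∀ q → inner (t a) p q ≡ true → reaches (t a) p ≡ true → t (blk u) ≡ star (pos {3 + k} u)
    not-clique-like q f reached
      with b , a≢b , linked ← linked-block c a
      with y , g ← outer-neighbour w b a≢b reached linked =
      contradiction (twofold (inner-neighbour w q f) g) (combine-≢ˡ a≢b)
    cases : ∀ s → t a ≡ s → t (blk u) ≡ star (pos {3 + k} u)
    cases clique ta with q , p≢q ← other p =
      not-clique-like q (trans (cong (λ s → inner s p q) ta) (cong not (⌊≟⌋-≢ p≢q))) (cong (λ s → reaches s p) ta)
    cases indep ta
      with b , d , a≢b , a≢d , b≢d ← two-others a
      with y , f ← outer-neighbour w b a≢b (cong (λ s → reaches s p) ta) (indep-linked c t valid ta b)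
      with z , g ← outer-neighbour w d a≢d (cong (λ s → reaches s p) ta) (indep-linked c t valid ta d) =
      contradiction (twofold f g) (combine-≢ˡ b≢d)
    cases (star x) ta = at-star (x ≟ p)
      where
      at-star : Dec (x ≡ p) → t (blk u) ≡ star (pos {3 + k} u)
      at-star (yes x≡p) with q , p≢q ← other p =
        not-clique-like q
          (trans (cong (λ s → inner s p q) (trans ta (cong star x≡p))) (cong₂ _xor_ (⌊≟⌋-refl p) (⌊≟⌋-≢ p≢q)))
          (trans (cong (λ s → reaches s p) (trans ta (cong star x≡p))) (⌊≟⌋-refl p))
      at-star (no x≢p) =
        trans (cong (t ∘ blk) u≡) (trans (cong t (block-combine a x)) (trans ta
          (cong star (sym (trans (cong (pos {3 + k}) u≡) (pos-combine a x))))))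
        where
        u≡ : u ≡ combine a x
        u≡ = sym (pendant _ (inner-neighbour w x
          (trans (cong (λ s → inner s p x) ta) (cong₂ _xor_ (⌊≟⌋-≢ x≢p) (⌊≟⌋-refl x)))))

star-centre : (s : BlockType n) → isStar s ≡ true → ∃[ x ] s ≡ star x
star-centre (star x) _ = x , refl

-- Each star block is sent to the block containing the image of its centre. The image is a support
-- vertex, hence the centre of a star block, and a star block has only one centre, so the map is
-- injective.
starCount-≤ : (c c′ : Centre (3 + k)) (t t′ : Types (3 + k) (2 + n)) → Valid c′ t′ →
  Iso (graph c t) (graph c′ t′) → starCount t ≤ starCount t′
starCount-≤ {k} {n} c c′ t t′ valid′ iso@(σ , _) =
  count-injection (isStar ∘ t) (isStar ∘ t′) (λ a f → blk (image a f))
    (λ a f → cong isStar (image-star a f))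
    λ a b f g e → combine-injectiveˡ a (proj₁ (star-centre (t a) f)) b (proj₁ (star-centre (t b) g))
      (Injection.injective (↔⇒↣ σ) (vertex-≡ {3 + k} {2 + n} e
        (star-injective (trans (sym (image-star a f)) (trans (cong t′ e) (image-star b g))))))
  where
  blk = block {3 + k} {2 + n}
  image : ∀ a → isStar (t a) ≡ true → Fin ((3 + k) * (2 + n))
  image a f = Inverse.to σ (combine a (proj₁ (star-centre (t a) f)))
  image-star : ∀ a f → t′ (blk (image a f)) ≡ star (pos {3 + k} (image a f))
  image-star a f = Support⇒star c′ t′ valid′ (image a f)
    (Support-iso iso (star⇒Support c t (proj₂ (star-centre (t a) f))))
  star-injective : ∀ {x y : Fin (2 + n)} → BlockType.star x ≡ star y → x ≡ y
  star-injective refl = refl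

-- Twin-free triangles and the kind of the centre node

Separated : Graph N → Fin N → Fin N → Set
Separated A u v = ∃[ z ] z ≢ u × z ≢ v × A u z ≢ A v z

-- Adjacent corners always disagree at each other, twins or not; for this reason the witness in
-- `Separated` has to differ from both vertices.
record TwinFreeTriangle (A : Graph N) : Set where
  constructor triangle
  field
    {u v w} : Fin N
    uv : A u v ≡ true
    vw : A v w ≡ true
    uw : A u w ≡ true
    u∣v : Separated A u v
    v∣w : Separated A v w
    u∣w : Separated A u w

TwinFreeTriangle-iso : {A B : Graph N} → Iso A B → TwinFreeTriangle A → TwinFreeTriangle B
TwinFreeTriangle-iso {A = A} {B} (σ , e) (triangle uv vw uw u∣v v∣w u∣w) =
  triangle (edge uv) (edge vw) (edge uw) (separated u∣v) (separated v∣w) (separated u∣w)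
  where
  open Inverse σ using (to)
  edge : ∀ {i j} → A i j ≡ true → B (to i) (to j) ≡ true
  edge {i} {j} f = trans (sym (e i j)) f
  separated : ∀ {i j} → Separated A i j → Separated B (to i) (to j)
  separated {i} {j} (z , z≢i , z≢j , differ) = to z , z≢i ∘ injective , z≢j ∘ injective ,
    λ f → differ (trans (e i z) (trans f (sym (e j z))))
    where injective = Injection.injective (↔⇒↣ σ)

-- The corners are vertices reaching the markers of three blocks. A second vertex `p` of block `a`
-- separates its corner from another one: if the block is `indep`, only the other corner is adjacent
-- to `p`; if it is a star, only its own corner, the star's centre, is.
complete⇒TwinFreeTriangle : (t : Types (3 + k) (2 + n)) → Valid nothing t → TwinFreeTriangle (graph nothing t)
complete⇒TwinFreeTriangle {k} {n} t (ok , _) =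
  triangle (edge zero b₁ λ ()) (edge b₁ b₂ λ ()) (edge zero b₂ λ ())
    (separated zero b₁ λ ()) (separated b₁ b₂ λ ()) (separated zero b₂ λ ())
  where
  b₁ b₂ : Fin (3 + k)
  b₁ = suc zero
  b₂ = suc (suc zero)
  y : ∀ a → Fin (2 + n)
  y a = proj₁ (reached-vertex (t a))
  y-reached : ∀ a → reaches (t a) (y a) ≡ true
  y-reached a = proj₂ (reached-vertex (t a))
  edge : ∀ a b → a ≢ b → graph nothing t (combine a (y a)) (combine b (y b)) ≡ true
  edge a b a≢b = trans (graph-combine nothing t a b _ _)
    (trans (adj-≢ nothing t a≢b) (cong₂ _∧_ (y-reached a) (cong (_∧ true) (y-reached b))))
  inner≢reaches : ∀ s x p → s ≢ clique → x ≢ p → reaches s x ≡ true → inner s x p ≢ reaches s p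
  inner≢reaches clique x p ≢c _ _ = contradiction refl ≢c
  inner≢reaches indep x p _ _ _ ()
  inner≢reaches (star z) x p _ x≢p r e with refl ← ⌊≟⌋⇒≡ {i = z} {x} r
    rewrite ⌊≟⌋-refl z | ⌊≟⌋-≢ x≢p with () ← e
  separated : ∀ a b → a ≢ b → Separated (graph nothing t) (combine a (y a)) (combine b (y b))
  separated a b a≢b with p , y≢p ← other (y a) =
    combine a p , combine-≢ʳ {a = a} {a} (y≢p ∘ sym) , combine-≢ˡ a≢b ,
    λ e → inner≢reaches (t a) (y a) p (ok a) y≢p (y-reached a) (begin
      inner (t a) (y a) p
        ≡⟨ adj-≡ nothing t a (y a) p ⟨
      adj nothing t a (y a) a p
        ≡⟨ graph-combine nothing t a a (y a) p ⟨
      graph nothing t (combine a (y a)) (combine a p)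
        ≡⟨ e ⟩
      graph nothing t (combine b (y b)) (combine a p)
        ≡⟨ graph-combine nothing t b a (y b) p ⟩
      adj nothing t b (y b) a p
        ≡⟨ adj-≢ nothing t (a≢b ∘ sym) ⟩
      reaches (t b) (y b) ∧ reaches (t a) p ∧ true
        ≡⟨ cong₂ _∧_ (y-reached b) (∧-identityʳ (reaches (t a) p)) ⟩
      reaches (t a) p ∎)
    where
    open ≡-Reasoning

graph-sym : (c : Centre k) (t : Types k n) (i j : Fin (k * n)) → graph c t i j ≡ graph c t j i
graph-sym {k} {n} c t i j = adj-sym c t (block {k} {n} i) (block {k} {n} j) (pos {k} i) (pos {k} j)

module _ {k n : ℕ} (r : Fin k) (t : Types k n) where

  private
    A : Graph (k * n)
    A = graph (just r) t
    blk : Fin (k * n) → Fin k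
    blk = block {k} {n}
    ps : Fin (k * n) → Fin n
    ps = pos {k} {n}

  edge⇒centre : ∀ {i j} → blk i ≢ blk j → A i j ≡ true → r ≡ blk i ⊎ r ≡ blk j
  edge⇒centre {i} {j} i≢j f
    with reaches (t (blk i)) (ps i) | reaches (t (blk j)) (ps j) | r ≟ blk i | r ≟ blk j
       | trans (sym (adj-≢ (just r) t {p = ps i} {q = ps j} i≢j)) f
  ... | _ | _ | yes e | _ | _ = inj₁ e
  ... | _ | _ | no _ | yes e | _ = inj₂ e
  ... | true | true | no _ | no _ | ()
  ... | true | false | no _ | no _ | ()

  same-block : ∀ {i j} → blk i ≡ blk j → A i j ≡ inner (t (blk i)) (ps i) (ps j)
  same-block {i} {j} e = trans (cong (λ b → adj (just r) t (blk i) (ps i) b (ps j)) (sym e))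
    (adj-≡ (just r) t (blk i) (ps i) (ps j))

  graph-irrefl : ∀ i → A i i ≡ false
  graph-irrefl i = adj-irrefl (just r) t (blk i) (ps i)

  no-loop : ∀ {i j} → i ≡ j → A i j ≢ true
  no-loop {i} refl f with () ← trans (sym f) (graph-irrefl i)

  -- Only a clique block can contain the edge: `indep` has none, and in a star one end would be a
  -- leaf although it also has the neighbour `l`. Two vertices of a clique block have the same
  -- neighbours elsewhere.
  twins : ∀ {i j l} → blk i ≡ blk j → A i j ≡ true → A i l ≡ true → A j l ≡ true → ¬ Separated A i j
  twins {i} {j} {l} e ij il jl (z , z≢i , z≢j , differ) = cases (t (blk i)) refl
    where
    ti≡tj : t (blk i) ≡ t (blk j)
    ti≡tj = cong t e
    cases : ∀ s → t (blk i) ≡ s → ⊥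
    cases clique ti = differ (agree (blk i ≟ blk z))
      where
      inside : ∀ {m} → t (blk m) ≡ clique → z ≢ m → blk m ≡ blk z → A m z ≡ true
      inside {m} tm z≢m f = trans (same-block f) (trans (cong (λ s → inner s (ps m) (ps z)) tm)
        (cong not (⌊≟⌋-≢ (λ g → z≢m (sym (vertex-≡ {k} {n} f g))))))
      outside : ∀ {m} → t (blk m) ≡ clique → blk m ≢ blk z →
        A m z ≡ reaches (t (blk z)) (ps z) ∧ link (just r) (blk m) (blk z)
      outside {m} tm f = trans (adj-≢ (just r) t f)
        (cong (λ s → reaches s (ps m) ∧ reaches (t (blk z)) (ps z) ∧ link (just r) (blk m) (blk z)) tm)
      agree : Dec (blk i ≡ blk z) → A i z ≡ A j z
      agree (yes f) = trans (inside ti z≢i f) (sym (inside (trans (sym ti≡tj) ti) z≢j (trans (sym e) f)))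
      agree (no f) = trans (outside ti f) (trans
        (cong (λ b → reaches (t (blk z)) (ps z) ∧ link (just r) b (blk z)) e)
        (sym (outside (trans (sym ti≡tj) ti) (f ∘ trans e))))
    cases indep ti with () ← trans (sym ij) (trans (same-block e) (cong (λ s → inner s (ps i) (ps j)) ti))
    cases (star x) ti = leaf (x ≟ ps i) (x ≟ ps j)
      where
      tj : t (blk j) ≡ star x
      tj = trans (sym ti≡tj) ti
      leaf : Dec (x ≡ ps i) → Dec (x ≡ ps j) → ⊥
      leaf (no x≢i) _ = no-loop (trans (leaf-neighbour (just r) t ti x≢i ij) (sym (leaf-neighbour (just r) t ti x≢i il))) jl
      leaf _ (no x≢j) = no-loop (trans (leaf-neighbour (just r) t tj x≢j (trans (graph-sym (just r) t j i) ij))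
        (sym (leaf-neighbour (just r) t tj x≢j jl))) il
      leaf (yes x≡i) (yes x≡j) = no-loop (vertex-≡ {k} {n} e (trans (sym x≡i) x≡j)) ij

  -- Two corners in one block would be twins. With three different blocks every edge has an end in
  -- block `r`, but the one corner in that block misses the opposite edge.
  star⇒¬TwinFreeTriangle : ¬ TwinFreeTriangle A
  star⇒¬TwinFreeTriangle (triangle {u} {v} {w} uv vw uw u∣v v∣w u∣w) =
    cases (blk u ≟ blk v) (blk v ≟ blk w) (blk u ≟ blk w)
    where
    swap : ∀ {i j} → A i j ≡ true → A j i ≡ true
    swap {i} {j} = trans (graph-sym (just r) t j i)
    cases : Dec (blk u ≡ blk v) → Dec (blk v ≡ blk w) → Dec (blk u ≡ blk w) → ⊥
    cases (yes e) _ _ = twins e uv uw vw u∣v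
    cases _ (yes e) _ = twins e vw (swap uv) (swap uw) v∣w
    cases _ _ (yes e) = twins e uw uv (swap vw) u∣w
    cases (no u≢v) (no v≢w) (no u≢w) with edge⇒centre u≢v uv | edge⇒centre v≢w vw | edge⇒centre u≢w uw
    ... | inj₁ e | inj₁ f | _ = u≢v (trans (sym e) f)
    ... | inj₁ e | inj₂ f | _ = u≢w (trans (sym e) f)
    ... | inj₂ e | _ | inj₁ f = u≢v (trans (sym f) e)
    ... | inj₂ e | _ | inj₂ f = v≢w (trans (sym e) f)

-- Representatives and the count

double-injective : ∀ {m m′} → m + m ≡ m′ + m′ → m ≡ m′
double-injective {m} {m′} e = trans (n≡⌊n+n/2⌋ m) (trans (cong ⌊_/2⌋ e) (sym (n≡⌊n+n/2⌋ m′)))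

starCount-iso : (c c′ : Centre (3 + k)) (t t′ : Types (3 + k) (2 + n)) → Valid c t → Valid c′ t′ →
  Iso (graph c t) (graph c′ t′) → starCount t ≡ starCount t′
starCount-iso c c′ t t′ valid valid′ iso =
  ≤-antisym (starCount-≤ c c′ t t′ valid′ iso) (starCount-≤ c′ c t′ t valid (Iso-sym iso))

module _ (k n : ℕ) where

  private
    K = 3 + k
    H = ⌈ K /2⌉

  complete-bound : (m : Fin H) → toℕ m + toℕ m ≤ 2 + k
  complete-bound m = s≤s⁻¹ (<⌈/2⌉⇒double< (toℕ<n m))

  star-bound : (j : Fin K) → toℕ j ≤ 2 + k
  star-bound j = s≤s⁻¹ (toℕ<n j)

  complete : Fin H → Types K (2 + n)
  complete m = completeTypes (toℕ m + toℕ m)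

  star-like : Fin K → Types K (2 + n)
  star-like j = starTypes (toℕ j)

  complete-valid : (m : Fin H) → Valid nothing (complete m)
  complete-valid m = Valid-completeTypes {2 + k} {1 + n} {toℕ m} (complete-bound m)

  star-valid : (j : Fin K) → Valid (just zero) (star-like j)
  star-valid j = Valid-starTypes {2 + k} {1 + n} (star-bound j)

  complete-count : (m : Fin H) → starCount (complete m) ≡ suc (toℕ m + toℕ m)
  complete-count m = starCount-completeTypes {2 + k} {1 + n} (complete-bound m)

  star-count : (j : Fin K) → starCount (star-like j) ≡ toℕ j
  star-count j = starCount-starTypes {2 + k} {1 + n} (star-bound j)

  complete≇star : (m : Fin H) (j : Fin K) →
    ¬ Iso (graph nothing (complete m)) (graph (just zero) (star-like j))
  complete≇star m j iso = star⇒¬TwinFreeTriangle zero (star-like j)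
    (TwinFreeTriangle-iso iso (complete⇒TwinFreeTriangle (complete m) (complete-valid m)))

  -- The two summands of the count: `inj₁ m` has 2m + 1 star blocks and a complete centre node,
  -- `inj₂ j` has `j` star blocks and a star as centre node.
  representative : Fin H ⊎ Fin K → Graph (K * (2 + n))
  representative (inj₁ m) = graph nothing (complete m)
  representative (inj₂ j) = graph (just zero) (star-like j)

  representative-distinct : ∀ s s′ → Iso (representative s) (representative s′) → s ≡ s′
  representative-distinct (inj₁ m) (inj₁ m′) iso = cong inj₁ (toℕ-injective (double-injective (suc-injective
    (trans (sym (complete-count m))
      (trans (starCount-iso nothing nothing (complete m) (complete m′) (complete-valid m) (complete-valid m′) iso)
        (complete-count m′))))))
  representative-distinct (inj₂ j) (inj₂ j′) iso = cong inj₂ (toℕ-injective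
    (trans (sym (star-count j))
      (trans (starCount-iso (just zero) (just zero) (star-like j) (star-like j′) (star-valid j) (star-valid j′) iso)
        (star-count j′))))
  representative-distinct (inj₁ m) (inj₂ j) iso = contradiction iso (complete≇star m j)
  representative-distinct (inj₂ j) (inj₁ m) iso = contradiction (Iso-sym iso) (complete≇star m j)

  representative-reached : (r : Fin K) → ∀ s → InOrbit (cliqueStar K (2 + n) r) (representative s)
  representative-reached r (inj₁ m)
    with reachable o ← reach-completeTypes {2 + k} {1 + n} r {toℕ m} (complete-bound m) = o
  representative-reached r (inj₂ j)
    with reachable o ← reach-starTypes {2 + k} {1 + n} r (star-bound j) = o

  representative-exists : (c : Centre K) (t : Types K (2 + n)) → Valid c t →
    ∃[ s ] Iso (graph c t) (representative s)
  representative-exists nothing t valid@(_ , parity) with m , e ← odd⇒1+double (starCount t) parity =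
    inj₁ (fromℕ< m<) , iso (fromℕ< m<) (toℕ-fromℕ< m<)
    where
    m< : m < H
    -- `m + m < K` unfolds to `suc (m + m) ≤ K`, the bound on the number of star blocks.
    m< = double<⇒<⌈/2⌉ (subst (_≤ K) e (count≤ (isStar ∘ t)))
    iso : (m₀ : Fin H) → toℕ m₀ ≡ m → Iso (graph nothing t) (representative (inj₁ m₀))
    iso m₀ refl = complete-iso t (complete m₀) valid (complete-valid m₀) (trans e (sym (complete-count m₀)))
  representative-exists (just r) t valid@(_ , parity) =
    inj₂ (fromℕ< j<) , iso (fromℕ< j<) (toℕ-fromℕ< j<)
    where
    j< : starCount t < K
    -- Block `r` is not a star, so at most `2 + k` of the `K` blocks are.
    j< = s≤s (subst (_≤ 2 + k) (sym (starCount-rest r t parity)) (count≤ (isStar ∘ t ∘ punchIn r)))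
    iso : (j : Fin K) → toℕ j ≡ starCount t → Iso (graph (just r) t) (representative (inj₂ j))
    iso j e = star-iso r zero t (star-like j) valid (star-valid j) (trans (sym e) (sym (star-count j)))

Iso-≗ : (A B C : Graph N) → (∀ i j → A i j ≡ B i j) → Iso B C → Iso A C
Iso-≗ A B C e (σ , f) = σ , λ i j → trans (e i j) (f i j)

theorem16 : (k n : ℕ) (r : Fin k) → 3 ≤ k → 2 ≤ n →
    OrbitIsoClassCount (cliqueStar k n r) (⌈ k /2⌉ + k)
theorem16 (suc (suc (suc k))) (suc (suc n)) r (s≤s (s≤s (s≤s z≤n))) (s≤s (s≤s z≤n)) =
  -- `splitAt H` and `join H K` identify the index set with the disjoint union of the two families.
  (λ a → rep (splitAt H a)) ,
  (λ a → representative-reached k n r (splitAt H a)) ,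
  (λ a b iso → trans (sym (join-splitAt H K a))
    (trans (cong (join H K) (representative-distinct k n (splitAt H a) (splitAt H b) iso)) (join-splitAt H K b))) ,
  classify
  where
  K = 3 + k
  H = ⌈ K /2⌉
  rep = representative k n
  classify : ∀ G → InOrbit (cliqueStar K (2 + n) r) G → ∃[ a ] Iso G (rep (splitAt H a))
  classify G (vs , e)
    with c , t , valid , f ← lcSeq-graph {K} {2 + n} vs (just r) (λ _ → clique) (Valid-cliqueStar {n = 2 + n} r)
    with s , iso ← representative-exists k n c t valid =
    join H K s , subst (λ s → Iso G (rep s)) (sym (splitAt-join H K s))
      (Iso-≗ G (graph c t) (rep s)
        (λ i j → trans (sym (e i j)) (trans (lcSeq-cong vs (cliqueStar-graph {K} {2 + n} r) i j) (f i j))) iso)
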